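{- Let $G$ be an ordered graph that is separable or nested. Then $sat_{<}(n,G)=\Theta(n)$.
   Context: An ordered graph is a finite simple graph whose vertex set is linearly ordered (identified with $[m]$ with the natural order). An ordered graph $H$ contains an ordered graph $G$ if there is an injective order-preserving map $\varphi:V(G)\to V(H)$ with $\varphi(u)\varphi(v)\in E(H)$ for all $uv\in E(G)$; otherwise $H$ avoids $G$. $H$ saturates $G$ if $H$ avoids $G$ but adding any non-edge $xy$ to $H$ yields a graph containing $G$. For $G$ with at least one edge, $sat_{<}(n,G)$ is the minimum number of edges of an ordered graph on $n$ vertices saturating $G$. Edges are written $uv$ with $u<v$. $G$ is separable if its edge set can be partitioned into two non-empty parts $E_1,E_2$ such that for all $u_1v_1\in E_1$ and $u_2v_2\in E_2$ we have $u_1<v_1<u_2<v_2$. $G$ is nested if its edge set can be partitioned into two non-empty parts $E_1,E_2$ such that for all $u_1v_1\in E_1$ and $u_2v_2\in E_2$ we have $u_1<u_2<v_2<v_1$. -}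

module Defs where

open import Data.Nat as ℕ using (ℕ; _≤_; _*_; _+_)
open import Data.Fin as Fin using (Fin; _≟_)
open import Data.Fin.Properties using (_<?_)
open import Data.Bool using (Bool; true; false; _∧_; _∨_; if_then_else_)
open import Data.List using (List; allFin; map)
open import Data.Nat.ListAction using (sum)
open import Data.Product using (Σ; _×_; ∃; ∃-syntax)
open import Relation.Nullary using (¬_)
open import Relation.Nullary.Decidable using (⌊_⌋)
open import Relation.Binary.PropositionalEquality using (_≡_)

-- An ordered graph on the vertex set [m] = Fin m (with its natural order).
-- adj u v = true with u < v means that uv is an edge; the values of adj at
-- pairs with u ≥ v are irrelevant (ignored everywhere below).
OGraph : ℕ → Set
OGraph m = Fin m → Fin m → Bool

IsEdge : ∀ {m} → OGraph m → Fin m → Fin m → Set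
IsEdge G u v = (u Fin.< v) × (G u v ≡ true)

IsNonEdge : ∀ {m} → OGraph m → Fin m → Fin m → Set
IsNonEdge G u v = (u Fin.< v) × (G u v ≡ false)

edgeCount : ∀ {m} → OGraph m → ℕ
edgeCount {m} G =
  sum (map (λ u → sum (map (λ v → if ⌊ u <? v ⌋ ∧ G u v then 1 else 0) (allFin m))) (allFin m))

Contains : ∀ {n m} → OGraph n → OGraph m → Set
Contains {n} {m} H G =
  Σ (Fin m → Fin n) λ φ →
    (∀ u v → u Fin.< v → φ u Fin.< φ v) ×
    (∀ u v → IsEdge G u v → IsEdge H (φ u) (φ v))

Avoids : ∀ {n m} → OGraph n → OGraph m → Set
Avoids H G = ¬ Contains H G

addEdge : ∀ {n} → OGraph n → Fin n → Fin n → OGraph n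
addEdge H x y u v = (⌊ u ≟ x ⌋ ∧ ⌊ v ≟ y ⌋) ∨ H u v

Saturates : ∀ {n m} → OGraph n → OGraph m → Set
Saturates H G =
  Avoids H G × (∀ x y → IsNonEdge H x y → Contains (addEdge H x y) G)

IsSat : ∀ {m} → ℕ → OGraph m → ℕ → Set
IsSat n G k =
  (Σ (OGraph n) λ H → Saturates H G × edgeCount H ≡ k) ×
  (∀ (H : OGraph n) → Saturates H G → k ≤ edgeCount H)

-- separable: edges split (by colouring c) into two non-empty classes E₁ (c = true)
-- and E₂ (c = false) with u₁ < v₁ < u₂ < v₂ for all u₁v₁ ∈ E₁, u₂v₂ ∈ E₂
Separable : ∀ {m} → OGraph m → Set
Separable {m} G =
  Σ (Fin m → Fin m → Bool) λ c →
    (∃[ u ] ∃[ v ] (IsEdge G u v × c u v ≡ true)) ×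
    (∃[ u ] ∃[ v ] (IsEdge G u v × c u v ≡ false)) ×
    (∀ u₁ v₁ u₂ v₂ → IsEdge G u₁ v₁ → c u₁ v₁ ≡ true →
                     IsEdge G u₂ v₂ → c u₂ v₂ ≡ false →
                     (u₁ Fin.< v₁) × (v₁ Fin.< u₂) × (u₂ Fin.< v₂))

Nested : ∀ {m} → OGraph m → Set
Nested {m} G =
  Σ (Fin m → Fin m → Bool) λ c →
    (∃[ u ] ∃[ v ] (IsEdge G u v × c u v ≡ true)) ×
    (∃[ u ] ∃[ v ] (IsEdge G u v × c u v ≡ false)) ×
    (∀ u₁ v₁ u₂ v₂ → IsEdge G u₁ v₁ → c u₁ v₁ ≡ true →
                     IsEdge G u₂ v₂ → c u₂ v₂ ≡ false →
                     (u₁ Fin.< u₂) × (u₂ Fin.< v₂) × (v₂ Fin.< v₁))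

{-# OPTIONS --safe #-}

-- Upper bound.  Let ij be a shortest edge of G.  The graph of all pairs that start
-- among the first i vertices or end among the last m − 1 − j has O(n) edges and
-- avoids G, because ij cannot be embedded; yet adding a pair at least as long as ij
-- creates G.  Any saturated supergraph therefore only gains short pairs, again O(n).
--
-- Lower bound.  If H has no copy of E₁ to the left of x (separable case; around
-- [x, y] in the nested case) and no copy of E₂ to the right of y (strictly between x
-- and y in the nested case), then whichever class does not use xy prevents xy from
-- creating a copy of G, so xy must be an edge of H.  Since copies of E₁ and E₂ in such
-- positions combine to a copy of G, extremal choices of x and y meet both conditions
-- and give a spanning star, respectively one edge from each vertex but the last.
module Submission where

open import Defs
open import Data.Nat using (ℕ; zero; suc; _+_; _∸_; _≤_; _*_; _<_; z≤n; s≤s; _≤?_)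
open import Data.Nat.Properties
open import Data.Nat.ListAction using (sum)
open import Data.Bool using (Bool; true; false; _∧_; _∨_; if_then_else_)
import Data.Bool.Properties as Bool
open import Data.Empty using (⊥)
open import Data.Fin as Fin using (Fin; zero; suc; toℕ; fromℕ<)
import Data.Fin.Properties as Fin
open import Data.List using (List; []; _∷_; allFin; map; cartesianProduct)
open import Data.List.Properties using (map-cong; map-tabulate)
open import Data.List.Membership.Propositional using (_∈_)
open import Data.List.Membership.Propositional.Properties using (∈-allFin; ∈-cartesianProduct⁺)
open import Data.List.Relation.Unary.Any using (here; there)
open import Data.Product using (Σ; _×_; ∃; ∃-syntax; _,_; proj₁; proj₂)
open import Data.Sum using (_⊎_; inj₁; inj₂; [_,_]′)
open import Data.Vec.Functional as Vector using (Vector; head; tail)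
open import Function using (_∘_; id)
open import Relation.Binary.Definitions using (Reflexive; tri<; tri≈; tri>)
open import Relation.Binary.PropositionalEquality
open import Relation.Nullary using (Dec; yes; no; ¬_; contradiction)
open import Relation.Nullary.Decidable using (⌊_⌋; map′; ¬?; _×-dec_; _→-dec_; _⊎-dec_)
open import Relation.Unary using (Decidable)

-- Boolean reflection, least witnesses and exhaustive search

⌊⌋⁺ : ∀ {A : Set} (a? : Dec A) → A → ⌊ a? ⌋ ≡ true
⌊⌋⁺ (yes _) _ = refl
⌊⌋⁺ (no ¬a) a = contradiction a ¬a

⌊⌋⁻ : ∀ {A : Set} (a? : Dec A) → ⌊ a? ⌋ ≡ true → A
⌊⌋⁻ (yes a) _ = a

∧⁻ : ∀ {a b} → a ∧ b ≡ true → a ≡ true × b ≡ true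
∧⁻ {true} {true} _ = refl , refl

∨⁻ : ∀ {a b} → a ∨ b ≡ true → a ≡ true ⊎ b ≡ true
∨⁻ {true}  _ = inj₁ refl
∨⁻ {false} p = inj₂ p

∨⁺ˡ : ∀ {a b} → a ≡ true → a ∨ b ≡ true
∨⁺ˡ refl = refl

∨⁺ʳ : ∀ {a b} → b ≡ true → a ∨ b ≡ true
∨⁺ʳ {a} refl = Bool.∨-zeroʳ a

least : ∀ {P : ℕ → Set} → Decidable P → ∀ {n} → P n →
        ∃[ k ] (P k × k ≤ n × (∀ j → P j → k ≤ j))
least P? {zero}  p = 0 , p , z≤n , λ _ _ → z≤n
least P? {suc n} p with P? 0
... | yes p₀ = 0 , p₀ , z≤n , λ _ _ → z≤n
... | no ¬p₀ with least (P? ∘ suc) p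
...   | k , pk , k≤n , min = suc k , pk , s≤s k≤n , λ where
        zero    p₀ → contradiction p₀ ¬p₀
        (suc j) pj → s≤s (min j pj)

-- Without function extensionality, exhaustive search over functions is limited
-- to predicates respecting pointwise equality.
Searchable : (A : Set) → (A → A → Set) → Set₁
Searchable A _≈_ =
  ∀ {P : A → Set} → (∀ {x y} → x ≈ y → P x → P y) → Decidable P → Dec (∃ P)

searchable-Bool : Searchable Bool _≡_
searchable-Bool _ P? = map′
  [ (λ p → true , p) , (λ p → false , p) ]′
  (λ { (true , p) → inj₁ p ; (false , p) → inj₂ p })
  (P? true ⊎-dec P? false)

searchable-Fin : ∀ {n} → Searchable (Fin n) _≡_
searchable-Fin _ = Fin.any?

-- A search for the head whose predicate is a search for the tail. A function is only pointwise
-- equal to the one rebuilt from its head and tail, and `resp` bridges that gap.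
searchable-Vector : ∀ {A : Set} {_≈_ : A → A → Set} → Reflexive _≈_ → Searchable A _≈_ →
                    ∀ n → Searchable (Vector A n) (λ f g → ∀ i → f i ≈ g i)
searchable-Vector ≈-refl search zero    resp P? =
  map′ (_ ,_) (λ (_ , p) → resp (λ ()) p) (P? Vector.[])
searchable-Vector ≈-refl search (suc n) resp P? = map′
  (λ (a , f , p) → a Vector.∷ f , p)
  (λ (f , p) → head f , tail f , resp (λ { zero → ≈-refl ; (suc _) → ≈-refl }) p)
  (search
    (λ a≈b (f , p) → f , resp (λ { zero → a≈b ; (suc _) → ≈-refl }) p)
    (λ a → searchable-Vector ≈-refl search n
      (λ f≈g → resp (λ { zero → ≈-refl ; (suc i) → f≈g i }))
      (λ f → P? (a Vector.∷ f))))

-- Sums over Fin n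

∑ : ∀ {n} → (Fin n → ℕ) → ℕ
∑ {n} f = sum (map f (allFin n))

∑-suc : ∀ {n} (f : Fin (suc n) → ℕ) → ∑ f ≡ f zero + ∑ (f ∘ suc)
∑-suc f = cong (λ xs → f zero + sum xs) (trans (map-tabulate suc f) (sym (map-tabulate id (f ∘ suc))))

∑-cong : ∀ {n} {f g : Fin n → ℕ} → (∀ i → f i ≡ g i) → ∑ f ≡ ∑ g
∑-cong {n} f≗g = cong sum (map-cong f≗g (allFin n))

∑-mono : ∀ {n} {f g : Fin n → ℕ} → (∀ i → f i ≤ g i) → ∑ f ≤ ∑ g
∑-mono {n} {f} {g} f≤g = go (allFin n)
  where
  go : ∀ xs → sum (map f xs) ≤ sum (map g xs)
  go []       = z≤n
  go (x ∷ xs) = +-mono-≤ (f≤g x) (go xs)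

∑-+ : ∀ {n} (f g : Fin n → ℕ) → ∑ (λ i → f i + g i) ≡ ∑ f + ∑ g
∑-+ {n} f g = go (allFin n)
  where
  go : ∀ xs → sum (map (λ i → f i + g i) xs) ≡ sum (map f xs) + sum (map g xs)
  go []       = refl
  go (x ∷ xs) = begin
    f x + g x + sum (map (λ i → f i + g i) xs)           ≡⟨ cong (f x + g x +_) (go xs) ⟩
    f x + g x + (sum (map f xs) + sum (map g xs))        ≡⟨ +-assoc (f x) (g x) _ ⟩
    f x + (g x + (sum (map f xs) + sum (map g xs)))      ≡⟨ cong (f x +_) (x∙yz≈y∙xz (g x) (sum (map f xs)) _) ⟩
    f x + (sum (map f xs) + (g x + sum (map g xs)))      ≡⟨ +-assoc (f x) _ _ ⟨
    f x + sum (map f xs) + (g x + sum (map g xs))        ∎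
    where
    open ≡-Reasoning
    open import Algebra.Properties.CommutativeSemigroup +-commutativeSemigroup using (x∙yz≈y∙xz)

-- The window from `a` to `a + k` serves whole ranges of rows, the part of one row beyond a vertex,
-- and a single term.
∑-lower : ∀ {n} a k c (f : Fin n → ℕ) → a + k ≤ n →
          (∀ i → a ≤ toℕ i → toℕ i < a + k → c ≤ f i) → k * c ≤ ∑ f
∑-lower zero zero c f _ _ = z≤n
∑-lower zero (suc k) c f (s≤s k≤n) c≤f rewrite ∑-suc f =
  +-mono-≤ (c≤f zero z≤n (s≤s z≤n))
           (∑-lower zero k c (f ∘ suc) k≤n λ i _ i<k → c≤f (suc i) z≤n (s≤s i<k))
∑-lower (suc a) k c f (s≤s a+k≤n) c≤f rewrite ∑-suc f =
  m≤n⇒m≤o+n (f zero)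
    (∑-lower a k c (f ∘ suc) a+k≤n λ i a≤i i<a+k → c≤f (suc i) (s≤s a≤i) (s≤s i<a+k))

-- The window may overrun `n`, as it does for short pairs near the last vertices.
∑-upper : ∀ {n} a k c (f : Fin n → ℕ) → (∀ i → f i ≤ c) →
          (∀ i → toℕ i < a ⊎ a + k ≤ toℕ i → f i ≡ 0) → ∑ f ≤ k * c
∑-upper {zero} a k c f _ _ = z≤n
∑-upper {suc n} zero zero c f f≤c f≡0 rewrite ∑-suc f | f≡0 zero (inj₂ z≤n) =
  ∑-upper zero zero c (f ∘ suc) (f≤c ∘ suc) λ i _ → f≡0 (suc i) (inj₂ z≤n)
∑-upper {suc n} zero (suc k) c f f≤c f≡0 rewrite ∑-suc f =
  +-mono-≤ (f≤c zero)
    (∑-upper zero k c (f ∘ suc) (f≤c ∘ suc) λ { i (inj₂ k≤i) → f≡0 (suc i) (inj₂ (s≤s k≤i)) })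
∑-upper {suc n} (suc a) k c f f≤c f≡0 rewrite ∑-suc f | f≡0 zero (inj₁ (s≤s z≤n)) =
  ∑-upper a k c (f ∘ suc) (f≤c ∘ suc) λ where
    i (inj₁ i<a)   → f≡0 (suc i) (inj₁ (s≤s i<a))
    i (inj₂ a+k≤i) → f≡0 (suc i) (inj₂ (s≤s a+k≤i))

𝟙 : Bool → ℕ
𝟙 b = if b then 1 else 0

𝟙≤1 : ∀ b → 𝟙 b ≤ 1
𝟙≤1 true  = s≤s z≤n
𝟙≤1 false = z≤n

𝟙-true : ∀ {b} → b ≡ true → 1 ≤ 𝟙 b
𝟙-true refl = s≤s z≤n

𝟙-no : ∀ {A : Set} (a? : Dec A) → ¬ A → 𝟙 ⌊ a? ⌋ ≡ 0
𝟙-no (yes a) ¬a = contradiction a ¬a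
𝟙-no (no _)  _  = refl

-- Ordered graphs

_⊆_ : ∀ {n} → OGraph n → OGraph n → Set
H ⊆ K = ∀ u v → H u v ≡ true → K u v ≡ true

_≐_ : ∀ {n} → OGraph n → OGraph n → Set
H ≐ K = ∀ u v → H u v ≡ K u v

≐-sym : ∀ {n} {H K : OGraph n} → H ≐ K → K ≐ H
≐-sym e u v = sym (e u v)

≐⇒⊆ : ∀ {n} {H K : OGraph n} → H ≐ K → H ⊆ K
≐⇒⊆ e u v p = trans (sym (e u v)) p

addEdge-⊇ : ∀ {n} (H : OGraph n) x y → H ⊆ addEdge H x y
addEdge-⊇ H x y u v = ∨⁺ʳ

addEdge-new : ∀ {n} (H : OGraph n) x y → addEdge H x y x y ≡ true
addEdge-new H x y = ∨⁺ˡ (cong₂ _∧_ (⌊⌋⁺ (x Fin.≟ x) refl) (⌊⌋⁺ (y Fin.≟ y) refl))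

addEdge⁻ : ∀ {n} (H : OGraph n) x y {u v} → addEdge H x y u v ≡ true →
           (u ≡ x × v ≡ y) ⊎ H u v ≡ true
addEdge⁻ H x y {u} {v} e with ∨⁻ e
... | inj₂ h = inj₂ h
... | inj₁ p with ∧⁻ p
...   | p , q = inj₁ (⌊⌋⁻ (u Fin.≟ x) p , ⌊⌋⁻ (v Fin.≟ y) q)

addEdge-⊆ : ∀ {n} {H K : OGraph n} {x y} → H ⊆ K → K x y ≡ true → addEdge H x y ⊆ K
addEdge-⊆ {H = H} {x = x} {y} H⊆K k u v e with addEdge⁻ H x y e
... | inj₁ (refl , refl) = k
... | inj₂ h             = H⊆K u v h

addEdge-mono : ∀ {n} {H K : OGraph n} {x y} → H ⊆ K → addEdge H x y ⊆ addEdge K x y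
addEdge-mono {K = K} {x} {y} H⊆K =
  addEdge-⊆ (λ u v h → addEdge-⊇ K x y u v (H⊆K u v h)) (addEdge-new K x y)

Contains-mono : ∀ {n m} {H K : OGraph n} {G : OGraph m} → H ⊆ K → Contains H G → Contains K G
Contains-mono H⊆K (φ , mono , emb) = φ , mono , λ u v e →
  let (lt , h) = emb u v e in lt , H⊆K _ _ h

isEdge? : ∀ {n} (H : OGraph n) u v → Dec (IsEdge H u v)
isEdge? H u v = (u Fin.<? v) ×-dec (H u v Bool.≟ true)

IsEdge-resp : ∀ {n} {H : OGraph n} {u u′ v v′} → u ≡ u′ → v ≡ v′ → IsEdge H u v → IsEdge H u′ v′
IsEdge-resp refl refl e = e

contains? : ∀ {n m} (H : OGraph n) (G : OGraph m) → Dec (Contains H G)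
contains? {n} {m} H G = searchable-Vector refl searchable-Fin m
  (λ φ≡ψ (mono , emb) →
    (λ u v lt → subst₂ Fin._<_ (φ≡ψ u) (φ≡ψ v) (mono u v lt)) ,
    (λ u v e → IsEdge-resp {H = H} (φ≡ψ u) (φ≡ψ v) (emb u v e)))
  (λ φ →
    Fin.all? (λ u → Fin.all? λ v → (u Fin.<? v) →-dec (φ u Fin.<? φ v)) ×-dec
    Fin.all? (λ u → Fin.all? λ v → isEdge? G u v →-dec isEdge? H (φ u) (φ v)))

saturates? : ∀ {n m} (H : OGraph n) (G : OGraph m) → Dec (Saturates H G)
saturates? H G = ¬? (contains? H G) ×-dec
  Fin.all? (λ x → Fin.all? λ y →
    ((x Fin.<? y) ×-dec (H x y Bool.≟ false)) →-dec contains? (addEdge H x y) G)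

Saturates-resp : ∀ {n m} {G : OGraph m} {H K : OGraph n} → H ≐ K → Saturates H G → Saturates K G
Saturates-resp H≐K (avoids , sat) =
  avoids ∘ Contains-mono (≐⇒⊆ (≐-sym H≐K)) ,
  λ x y (lt , k) → Contains-mono (addEdge-mono (≐⇒⊆ H≐K)) (sat x y (lt , trans (H≐K x y) k))

row : ∀ {n} → OGraph n → Fin n → ℕ
row H u = ∑ (λ v → 𝟙 (⌊ u Fin.<? v ⌋ ∧ H u v))

edgeCount-resp : ∀ {n} {H K : OGraph n} → H ≐ K → edgeCount H ≡ edgeCount K
edgeCount-resp H≐K = ∑-cong λ u → ∑-cong λ v → cong (λ b → 𝟙 (⌊ u Fin.<? v ⌋ ∧ b)) (H≐K u v)

-- The edge counts of saturating graphs form a nonempty decidable set, so a least one exists.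
-- Decidability is a search through all adjacency matrices, taken as vectors of Boolean vectors;
-- this is where invariance under `_≐_` enters.
IsSat-exists : ∀ {n m} (G : OGraph m) (H : OGraph n) → Saturates H G → ∃[ k ] IsSat n G k
IsSat-exists {n} G H sat with least attained? (H , sat , refl)
  where
  attained? : ∀ k → Dec (Σ (OGraph n) λ K → Saturates K G × edgeCount K ≡ k)
  attained? k = searchable-Vector (λ _ → refl) (searchable-Vector refl searchable-Bool n) n
    (λ K≐K′ (sat , e) → Saturates-resp K≐K′ sat , trans (sym (edgeCount-resp K≐K′)) e)
    (λ K → saturates? K G ×-dec (edgeCount K ≟ k))
... | k , K , _ , min = k , K , λ H′ sat′ → min _ (H′ , sat′ , refl)

-- Greedy saturation: a pair rejected once stays rejected as the graph grows.
saturate : ∀ {n m} (G : OGraph m) (H : OGraph n) → Avoids H G →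
           Σ (OGraph n) λ K → H ⊆ K × Saturates K G
saturate {n} G H avoids with go (cartesianProduct (allFin n) (allFin n)) H avoids
  where
  go : ∀ (ps : List (Fin n × Fin n)) (H : OGraph n) → Avoids H G →
       Σ (OGraph n) λ K → H ⊆ K × Avoids K G ×
         (∀ {x y} → (x , y) ∈ ps → IsNonEdge K x y → Contains (addEdge K x y) G)
  go [] H avoids = H , (λ _ _ → id) , avoids , λ ()
  go ((x , y) ∷ ps) H avoids with contains? (addEdge H x y) G
  ... | yes c with go ps H avoids
  ...   | K , H⊆K , avoidsK , sat = K , H⊆K , avoidsK , λ where
          (here refl) _ → Contains-mono (addEdge-mono H⊆K) c
          (there p)     → sat p
  go ((x , y) ∷ ps) H avoids | no ¬c with go ps (addEdge H x y) ¬c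
  ...   | K , H⁺⊆K , avoidsK , sat = K , (λ u v h → H⁺⊆K u v (addEdge-⊇ H x y u v h)) , avoidsK , λ where
          (here refl) (_ , k) → contradiction (trans (sym k) (H⁺⊆K x y (addEdge-new H x y))) λ ()
          (there p)           → sat p
... | K , H⊆K , avoidsK , sat = K , H⊆K , avoidsK ,
      λ x y → sat (∈-cartesianProduct⁺ (∈-allFin x) (∈-allFin y))

-- Upper bound: order-preserving maps, the border graph and its saturation

toℕ-mono-lower : ∀ {m n} (φ : Fin m → Fin n) → (∀ u v → u Fin.< v → φ u Fin.< φ v) →
                 ∀ a → (∀ u → a ≤ toℕ (φ u)) → ∀ u → a + toℕ u ≤ toℕ (φ u)
toℕ-mono-lower φ mono a a≤φ zero    = subst (_≤ toℕ (φ zero)) (sym (+-identityʳ a)) (a≤φ zero)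
-- Everything after the first vertex lands strictly above it, so dropping that vertex raises the
-- floor from `a` to `suc a`.
toℕ-mono-lower φ mono a a≤φ (suc u) = subst (_≤ toℕ (φ (suc u))) (sym (+-suc a (toℕ u)))
  (toℕ-mono-lower (φ ∘ suc) (λ u v lt → mono (suc u) (suc v) (s≤s lt)) (suc a)
    (λ v → ≤-<-trans (a≤φ zero) (mono zero (suc v) (s≤s z≤n))) u)

toℕ-mono-upper : ∀ {m n} (φ : Fin m → Fin n) → (∀ u v → u Fin.< v → φ u Fin.< φ v) →
                 ∀ u → toℕ (φ u) + (m ∸ suc (toℕ u)) < n
toℕ-mono-upper {suc m} φ mono zero = ≤-<-trans
  (subst (λ k → toℕ (φ zero) + k ≤ toℕ (φ last)) (Fin.toℕ-fromℕ m)
    (toℕ-mono-lower φ mono (toℕ (φ zero))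
      (λ { zero → ≤-refl ; (suc v) → <⇒≤ (mono zero (suc v) (s≤s z≤n)) }) last))
  (Fin.toℕ<n (φ last))
  where last = Fin.fromℕ m
toℕ-mono-upper {suc m} φ mono (suc u) =
  toℕ-mono-upper (φ ∘ suc) (λ u v lt → mono (suc u) (suc v) (s≤s lt)) u

-- An edge of least length spans no other edge: an edge within the interval from `i` to `j` is at
-- least as long as `ij`, so it fills the interval.
shortest-edge : ∀ {m} (G : OGraph m) → (∃[ u ] ∃[ v ] IsEdge G u v) →
  ∃[ i ] ∃[ j ] (IsEdge G i j × (∀ u v → IsEdge G u v → toℕ i ≤ toℕ u → toℕ v ≤ toℕ j → u ≡ i × v ≡ j))
shortest-edge {m} G (u₀ , v₀ , e₀) with least ofLength? (u₀ , v₀ , e₀ , refl)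
  where
  ofLength? : ∀ k → Dec (∃[ u ] ∃[ v ] (IsEdge G u v × toℕ v ∸ toℕ u ≡ k))
  ofLength? k = Fin.any? λ u → Fin.any? λ v → isEdge? G u v ×-dec (toℕ v ∸ toℕ u ≟ k)
... | _ , (i , j , ij@(i<j , _) , refl) , _ , min = i , j , ij , unique
  where
  open ≤-Reasoning

  unique : ∀ u v → IsEdge G u v → toℕ i ≤ toℕ u → toℕ v ≤ toℕ j → u ≡ i × v ≡ j
  unique u v uv@(u<v , _) i≤u v≤j =
    Fin.toℕ-injective (≤-antisym u≤i i≤u) , Fin.toℕ-injective (≤-antisym v≤j j≤v)
    where
    shorter : toℕ j ∸ toℕ i ≤ toℕ v ∸ toℕ u
    shorter = min _ (u , v , uv , refl)

    u≤i : toℕ u ≤ toℕ i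
    u≤i = +-cancelˡ-≤ (toℕ v ∸ toℕ u) _ _ (begin
      toℕ v ∸ toℕ u + toℕ u ≡⟨ m∸n+n≡m (<⇒≤ u<v) ⟩
      toℕ v                 ≤⟨ v≤j ⟩
      toℕ j                 ≡⟨ m∸n+n≡m (<⇒≤ i<j) ⟨
      toℕ j ∸ toℕ i + toℕ i ≤⟨ +-monoˡ-≤ (toℕ i) shorter ⟩
      toℕ v ∸ toℕ u + toℕ i ∎)

    j≤v : toℕ j ≤ toℕ v
    j≤v = begin
      toℕ j                 ≡⟨ m∸n+n≡m (<⇒≤ i<j) ⟨
      toℕ j ∸ toℕ i + toℕ i ≤⟨ +-mono-≤ shorter i≤u ⟩
      toℕ v ∸ toℕ u + toℕ u ≡⟨ m∸n+n≡m (<⇒≤ u<v) ⟩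
      toℕ v                 ∎

-- A single jump, the building block of the nondecreasing `shift` in `border-creates`.
step : ℕ → ℕ → ℕ → ℕ
step k d w with k ≤? w
... | yes _ = d
... | no  _ = 0

step-above : ∀ {k w} d → k ≤ w → step k d w ≡ d
step-above {k} {w} d k≤w with k ≤? w
... | yes _  = refl
... | no k≰w = contradiction k≤w k≰w

step-below : ∀ {k w} d → w < k → step k d w ≡ 0
step-below {k} {w} d w<k with k ≤? w
... | yes k≤w = contradiction w<k (≤⇒≯ k≤w)
... | no _    = refl

step-mono : ∀ k d {w w′} → w ≤ w′ → step k d w ≤ step k d w′
step-mono k d {w} {w′} w≤w′ with k ≤? w
... | yes k≤w = ≤-reflexive (sym (step-above d (≤-trans k≤w w≤w′)))
... | no _    = z≤n

step≤ : ∀ k d w → step k d w ≤ d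
step≤ k d w with k ≤? w
... | yes _ = ≤-refl
... | no  _ = z≤n

border : ∀ {m} n → Fin m → Fin m → OGraph n
border {m} n i j x y = ⌊ toℕ x <? toℕ i ⌋ ∨ ⌊ n ≤? toℕ y + (m ∸ suc (toℕ j)) ⌋

-- An order-preserving map leaves at least `toℕ i` vertices before the image of `i` and at least
-- `m ∸ suc (toℕ j)` after the image of `j`, so the image of `ij` is never a border pair.
border-avoids : ∀ {m} n (G : OGraph m) i j → IsEdge G i j → Avoids (border n i j) G
border-avoids {m} n G i j ij (φ , mono , emb) with ∨⁻ (proj₂ (emb i j ij))
... | inj₁ p = <⇒≱ (⌊⌋⁻ (toℕ (φ i) <? toℕ i) p) (toℕ-mono-lower φ mono 0 (λ _ → z≤n) i)
... | inj₂ p = <⇒≱ (toℕ-mono-upper φ mono j) (⌊⌋⁻ (n ≤? toℕ (φ j) + (m ∸ suc (toℕ j))) p)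

-- The vertices before i stay at the left end, i goes to x, j to y, and the
-- vertices after j go to the right end: w is shifted by a nondecreasing amount.
border-creates : ∀ {m} n (G : OGraph m) i j → IsEdge G i j →
  (∀ u v → IsEdge G u v → toℕ i ≤ toℕ u → toℕ v ≤ toℕ j → u ≡ i × v ≡ j) →
  ∀ x y → x Fin.< y → border n i j x y ≡ false → toℕ x + toℕ j ≤ toℕ y + toℕ i →
  Contains (addEdge (border n i j) x y) G
border-creates {m} n G i j (i<j , _) shortest x y x<y b≡f long
  -- The three gaps: x = i + p because `x` is not among the first i vertices, n = y + b + 1 + e
  -- because `y` is not among the last b = m - 1 - j, and then y = j + p + q because `xy` is at
  -- least as long as `ij`.
  with m≤n⇒∃[o]m+o≡n (≮⇒≥ {toℕ x} {toℕ i} λ x<i →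
         contradiction (trans (sym b≡f) (∨⁺ˡ (⌊⌋⁺ (toℕ x <? toℕ i) x<i))) λ ())
     | m≤n⇒∃[o]m+o≡n (≰⇒> {n} {toℕ y + (m ∸ suc (toℕ j))} λ n≤ →
         contradiction (trans (sym b≡f) (∨⁺ʳ (⌊⌋⁺ (n ≤? toℕ y + (m ∸ suc (toℕ j))) n≤))) λ ())
... | p , x≡i+p | e , n≡y+b+e
  with m≤n⇒∃[o]m+o≡n (+-cancelˡ-≤ (toℕ i) (toℕ j + p) (toℕ y) (begin
         toℕ i + (toℕ j + p) ≡⟨ x∙yz≈xz∙y (toℕ i) (toℕ j) p ⟩
         toℕ i + p + toℕ j   ≡⟨ cong (_+ toℕ j) x≡i+p ⟩
         toℕ x + toℕ j       ≤⟨ long ⟩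
         toℕ y + toℕ i       ≡⟨ +-comm (toℕ y) (toℕ i) ⟩
         toℕ i + toℕ y       ∎))
  where
  open ≤-Reasoning
  open import Algebra.Properties.CommutativeSemigroup +-commutativeSemigroup using (x∙yz≈xz∙y)
... | q , y≡j+p+q = φ , φ-mono , φ-emb
  where
  b = m ∸ suc (toℕ j)

  -- The values are 0 before i, p from i up to j, p + q at j, and p + q + e after j.
  shift : ℕ → ℕ
  shift w = step (toℕ i) p w + (step (toℕ j) q w + step (suc (toℕ j)) e w)

  shift-mono : ∀ {w w′} → w ≤ w′ → shift w ≤ shift w′
  shift-mono w≤w′ = +-mono-≤ (step-mono (toℕ i) p w≤w′)
    (+-mono-≤ (step-mono (toℕ j) q w≤w′) (step-mono (suc (toℕ j)) e w≤w′))

  shift≤ : ∀ w → shift w ≤ p + (q + e)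
  shift≤ w = +-mono-≤ (step≤ (toℕ i) p w) (+-mono-≤ (step≤ (toℕ j) q w) (step≤ (suc (toℕ j)) e w))

  n≡ : suc (toℕ j) + b + (p + (q + e)) ≡ n
  n≡ = trans (lemma (toℕ j) b p q e) (trans (cong (λ y → suc (y + b) + e) y≡j+p+q) n≡y+b+e)
    where
    open import Data.Nat.Tactic.RingSolver using (solve-∀)
    lemma : ∀ j b p q e → suc j + b + (p + (q + e)) ≡ suc (j + p + q + b) + e
    lemma = solve-∀

  j+b : suc (toℕ j) + b ≡ m
  j+b = m+[n∸m]≡n (Fin.toℕ<n j)

  shift-bound : ∀ (w : Fin m) → toℕ w + shift (toℕ w) < n
  shift-bound w = subst (toℕ w + shift (toℕ w) <_) n≡
    (+-mono-<-≤ (subst (toℕ w <_) (sym j+b) (Fin.toℕ<n w)) (shift≤ (toℕ w)))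

  φ : Fin m → Fin n
  φ w = fromℕ< (shift-bound w)

  toℕ-φ : ∀ w → toℕ (φ w) ≡ toℕ w + shift (toℕ w)
  toℕ-φ w = Fin.toℕ-fromℕ< (shift-bound w)

  φ-mono : ∀ u v → u Fin.< v → φ u Fin.< φ v
  φ-mono u v u<v = subst₂ _<_ (sym (toℕ-φ u)) (sym (toℕ-φ v)) (+-mono-<-≤ u<v (shift-mono (<⇒≤ u<v)))

  φ-left : ∀ w → toℕ w < toℕ i → toℕ (φ w) < toℕ i
  φ-left w w<i = subst (_< toℕ i) (sym (trans (toℕ-φ w) (begin
    toℕ w + shift (toℕ w) ≡⟨ cong (toℕ w +_) (cong₂ _+_ (step-below p w<i)
                               (cong₂ _+_ (step-below q w<j) (step-below e (m<n⇒m<1+n w<j)))) ⟩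
    toℕ w + 0             ≡⟨ +-identityʳ (toℕ w) ⟩
    toℕ w                 ∎))) w<i
    where
    open ≡-Reasoning
    w<j = <-trans w<i i<j

  φ-right : ∀ w → toℕ j < toℕ w → n ≤ toℕ (φ w) + b
  φ-right w j<w = subst₂ _≤_ n≡ (cong (_+ b) (sym (toℕ-φ w))) (begin
    suc (toℕ j) + b + (p + (q + e)) ≡⟨ xy∙z≈xz∙y (suc (toℕ j)) b _ ⟩
    suc (toℕ j) + (p + (q + e)) + b ≡⟨ cong (λ s → suc (toℕ j) + s + b) (cong₂ _+_
                                         (step-above p (≤-trans (<⇒≤ i<j) (<⇒≤ j<w)))
                                         (cong₂ _+_ (step-above q (<⇒≤ j<w)) (step-above e j<w))) ⟨
    suc (toℕ j) + shift (toℕ w) + b ≤⟨ +-monoˡ-≤ b (+-monoˡ-≤ (shift (toℕ w)) j<w) ⟩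
    toℕ w + shift (toℕ w) + b       ∎)
    where
    open ≤-Reasoning
    open import Algebra.Properties.CommutativeSemigroup +-commutativeSemigroup using (xy∙z≈xz∙y)

  φ-i : φ i ≡ x
  φ-i = Fin.toℕ-injective (trans (toℕ-φ i) (trans (cong (toℕ i +_) (begin
    shift (toℕ i) ≡⟨ cong₂ _+_ (step-above p (≤-refl {toℕ i}))
                       (cong₂ _+_ (step-below q i<j) (step-below e (m<n⇒m<1+n i<j))) ⟩
    p + 0         ≡⟨ +-identityʳ p ⟩
    p             ∎)) x≡i+p))
    where open ≡-Reasoning

  φ-j : φ j ≡ y
  φ-j = Fin.toℕ-injective (trans (toℕ-φ j) (trans (begin
    toℕ j + shift (toℕ j) ≡⟨ cong (toℕ j +_) (cong₂ _+_ (step-above p (<⇒≤ i<j))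
                               (cong₂ _+_ (step-above q (≤-refl {toℕ j})) (step-below e (n<1+n (toℕ j))))) ⟩
    toℕ j + (p + (q + 0)) ≡⟨ cong (λ q → toℕ j + (p + q)) (+-identityʳ q) ⟩
    toℕ j + (p + q)       ≡⟨ +-assoc (toℕ j) p q ⟨
    toℕ j + p + q         ∎) y≡j+p+q))
    where open ≡-Reasoning

  H = border n i j

  φ-emb : ∀ u v → IsEdge G u v → IsEdge (addEdge H x y) (φ u) (φ v)
  φ-emb u v uv@(u<v , _) = φ-mono u v u<v , edge
    where
    edge : addEdge H x y (φ u) (φ v) ≡ true
    -- An edge starting before `i` or ending after `j` lands in the border. Any other lies within
    -- the span of `ij`, hence is `ij`, and lands on `xy`.
    edge with <-≤-connex (toℕ u) (toℕ i) | <-≤-connex (toℕ j) (toℕ v)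
    ... | inj₁ u<i | _        = addEdge-⊇ H x y (φ u) (φ v) (∨⁺ˡ (⌊⌋⁺ (toℕ (φ u) <? toℕ i) (φ-left u u<i)))
    ... | inj₂ _   | inj₁ j<v = addEdge-⊇ H x y (φ u) (φ v) (∨⁺ʳ (⌊⌋⁺ (n ≤? toℕ (φ v) + b) (φ-right v j<v)))
    ... | inj₂ i≤u | inj₂ v≤j with shortest u v uv i≤u v≤j
    ...   | refl , refl = subst₂ (λ a b → addEdge H x y a b ≡ true) (sym φ-i) (sym φ-j) (addEdge-new H x y)

-- The first `m` rows, the last `m` columns and a diagonal band of width `m` cover all edges, and
-- each contains at most `m * n` pairs.
edgeCount-upper : ∀ {n} m (H : OGraph n) →
  (∀ u v → IsEdge H u v → toℕ u < m ⊎ n ≤ toℕ v + m ⊎ toℕ v < toℕ u + m) →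
  edgeCount H ≤ 3 * m * n
edgeCount-upper {n} m H cases = begin
  edgeCount H                                      ≤⟨ ∑-mono row≤ ⟩
  ∑ {n} (λ u → n * left u + (m * 1 + m * 1))       ≡⟨ ∑-+ (λ u → n * left u) _ ⟩
  ∑ {n} (λ u → n * left u) + ∑ {n} (λ u → m * 1 + m * 1)
    ≤⟨ +-mono-≤
         (∑-upper {n} 0 m (n * 1) _ (λ u → *-monoʳ-≤ n (𝟙≤1 _))
           λ { u (inj₂ m≤u) → trans (cong (n *_) (𝟙-no (toℕ u <? m) (≤⇒≯ m≤u))) (*-zeroʳ n) })
         (∑-upper {n} 0 n (m * 1 + m * 1) _ (λ _ → ≤-refl)
           λ { u (inj₂ n≤u) → contradiction (Fin.toℕ<n u) (≤⇒≯ n≤u) }) ⟩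
  m * (n * 1) + n * (m * 1 + m * 1)                ≡⟨ lemma m n ⟩
  3 * m * n                                        ∎
  where
  open ≤-Reasoning
  open import Data.Nat.Tactic.RingSolver using (solve-∀)

  lemma : ∀ m n → m * (n * 1) + n * (m * 1 + m * 1) ≡ 3 * m * n
  lemma = solve-∀

  left : Fin n → ℕ
  left u = 𝟙 ⌊ toℕ u <? m ⌋

  right : Fin n → ℕ
  right v = 𝟙 ⌊ n ≤? toℕ v + m ⌋

  -- The condition `toℕ u ≤ toℕ v` turns the band in row `u` into a window of length `m` starting at
  -- `u`, as `∑-upper` expects.
  short? : ∀ (u v : Fin n) → Dec (toℕ u ≤ toℕ v × toℕ v < toℕ u + m)
  short? u v = (toℕ u ≤? toℕ v) ×-dec (toℕ v <? toℕ u + m)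

  short : Fin n → Fin n → ℕ
  short u v = 𝟙 ⌊ short? u v ⌋

  entry≤ : ∀ u v → 𝟙 (⌊ u Fin.<? v ⌋ ∧ H u v) ≤ left u + (right v + short u v)
  entry≤ u v with u Fin.<? v
  ... | no  _   = z≤n
  ... | yes u<v with H u v in uv
  ...   | false = z≤n
  ...   | true with cases u v (u<v , uv)
  ...     | inj₁ l        = m≤n⇒m≤n+o _ (𝟙-true (⌊⌋⁺ (toℕ u <? m) l))
  ...     | inj₂ (inj₁ r) = m≤n⇒m≤o+n (left u) (m≤n⇒m≤n+o _ (𝟙-true (⌊⌋⁺ (n ≤? toℕ v + m) r)))
  ...     | inj₂ (inj₂ s) =
    m≤n⇒m≤o+n (left u) (m≤n⇒m≤o+n (right v) (𝟙-true (⌊⌋⁺ (short? u v) (<⇒≤ u<v , s))))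

  row≤ : ∀ u → row H u ≤ n * left u + (m * 1 + m * 1)
  row≤ u = begin
    row H u                                          ≤⟨ ∑-mono (entry≤ u) ⟩
    ∑ {n} (λ v → left u + (right v + short u v))     ≡⟨ ∑-+ {n} (λ _ → left u) _ ⟩
    ∑ {n} (λ _ → left u) + ∑ {n} (λ v → right v + short u v)
      ≡⟨ cong (∑ {n} (λ _ → left u) +_) (∑-+ right (short u)) ⟩
    ∑ {n} (λ _ → left u) + (∑ right + ∑ (short u))
      ≤⟨ +-mono-≤
           (∑-upper {n} 0 n (left u) _ (λ _ → ≤-refl)
             λ { v (inj₂ n≤v) → contradiction (Fin.toℕ<n v) (≤⇒≯ n≤v) })
           (+-mono-≤
             (∑-upper (n ∸ m) m 1 right (λ v → 𝟙≤1 _) λ where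
               v (inj₁ v<n∸m) → 𝟙-no (n ≤? toℕ v + m) λ n≤v+m →
                 <⇒≱ v<n∸m (m≤n+o⇒m∸n≤o n m (subst (n ≤_) (+-comm (toℕ v) m) n≤v+m))
               v (inj₂ n≤v)   → contradiction (Fin.toℕ<n v) (≤⇒≯ (≤-trans (m≤n∸m+m m n) n≤v)))
             (∑-upper (toℕ u) m 1 (short u) (λ v → 𝟙≤1 _) λ where
               v (inj₁ v<u) → 𝟙-no (short? u v) λ (u≤v , _) → <⇒≱ v<u u≤v
               v (inj₂ far) → 𝟙-no (short? u v) λ (_ , near) → <⇒≱ near far)) ⟩
    n * left u + (m * 1 + m * 1) ∎
    where
    m≤n∸m+m : ∀ m n → n ≤ n ∸ m + m
    m≤n∸m+m m n = subst (n ≤_) (+-comm m (n ∸ m)) (m≤n+m∸n n m)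

saturated-linear : ∀ {m} (G : OGraph m) → (∃[ u ] ∃[ v ] IsEdge G u v) → ∀ n →
                   Σ (OGraph n) λ H → Saturates H G × edgeCount H ≤ 3 * m * n
saturated-linear {m} G edge n with shortest-edge G edge
... | i , j , ij , shortest with saturate G (border n i j) (border-avoids n G i j ij)
...   | H , B⊆H , sat@(avoids , _) = H , sat , edgeCount-upper m H cases
  where
  cases : ∀ x y → IsEdge H x y → toℕ x < m ⊎ n ≤ toℕ y + m ⊎ toℕ y < toℕ x + m
  cases x y (x<y , xy) with border n i j x y in b
  ... | true with ∨⁻ b
  ...   | inj₁ l = inj₁ (<-trans (⌊⌋⁻ (toℕ x <? toℕ i) l) (Fin.toℕ<n i))
  ...   | inj₂ r = inj₂ (inj₁ (≤-trans (⌊⌋⁻ (n ≤? toℕ y + (m ∸ suc (toℕ j))) r)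
                                       (+-monoʳ-≤ (toℕ y) (m∸n≤m m (suc (toℕ j))))))
  -- `H` contains the border and `xy`, so a long `xy` outside the border would put a copy of `G`
  -- into `H`. A short one satisfies y ≤ y + i < x + j < x + m.
  cases x y (x<y , xy) | false with toℕ x + toℕ j ≤? toℕ y + toℕ i
  ...   | yes long = contradiction
          (Contains-mono (addEdge-⊆ B⊆H xy) (border-creates n G i j ij shortest x y x<y b long)) avoids
  ...   | no ¬long = inj₂ (inj₂ (≤-<-trans (m≤m+n (toℕ y) (toℕ i))
          (<-trans (≰⇒> ¬long) (+-monoʳ-< (toℕ x) (Fin.toℕ<n j)))))

-- Lower bound: edges forced by partial copies of the two classes

∑-term : ∀ {n} (f : Fin n → ℕ) i → f i ≤ ∑ f
∑-term f i = subst (_≤ ∑ f) (*-identityˡ (f i))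
  (∑-lower (toℕ i) 1 (f i) f (≤-trans (≤-reflexive (+-comm (toℕ i) 1)) (Fin.toℕ<n i)) λ j i≤j j<i+1 →
    ≤-reflexive (cong f (Fin.toℕ-injective
      (≤-antisym i≤j (m<1+n⇒m≤n (subst (toℕ j <_) (+-comm (toℕ i) 1) j<i+1))))))

entry-edge : ∀ {n} (H : OGraph n) {u v} → IsEdge H u v → 1 ≤ 𝟙 (⌊ u Fin.<? v ⌋ ∧ H u v)
entry-edge H {u} {v} (u<v , h) = 𝟙-true (cong₂ _∧_ (⌊⌋⁺ (u Fin.<? v) u<v) h)

row-edge : ∀ {n} (H : OGraph n) {u v} → IsEdge H u v → 1 ≤ row H u
row-edge H {u} {v} e = ≤-trans (entry-edge H e) (∑-term (λ v → 𝟙 (⌊ u Fin.<? v ⌋ ∧ H u v)) v)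

strictMono⇒injective : ∀ {m n} (φ : Fin m → Fin n) → (∀ u v → u Fin.< v → φ u Fin.< φ v) →
                       ∀ {u v} → φ u ≡ φ v → u ≡ v
strictMono⇒injective φ mono {u} {v} eq with Fin.<-cmp u v
... | tri< u<v _ _ = contradiction eq (Fin.<⇒≢ (mono u v u<v))
... | tri≈ _ u≡v _ = u≡v
... | tri> _ _ v<u = contradiction (sym eq) (Fin.<⇒≢ (mono v u v<u))

-- The edges of class false live on an interval of vertices, with L on its left
-- and R on its right; those of class true live on L ∪ R.
module TwoPart {m} (G : OGraph m) (c : Fin m → Fin m → Bool)
  (L R : Fin m → Set) (L? : Decidable L) (R? : Decidable R)
  (L-down : ∀ {u v} → u Fin.< v → L v → L u)
  (R-up : ∀ {u v} → u Fin.< v → R u → R v)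
  (inner-edge : ∀ {u v} → IsEdge G u v → c u v ≡ false → (¬ L u × ¬ R u) × (¬ L v × ¬ R v))
  (outer-edge : ∀ {u v} → IsEdge G u v → c u v ≡ true → (L u ⊎ R u) × (L v ⊎ R v))
  where

  Inner Outer : Fin m → Set
  Inner w = ¬ L w × ¬ R w
  Outer w = L w ⊎ R w

  place : ∀ w → Inner w ⊎ Outer w
  place w with L? w | R? w
  ... | yes l | _     = inj₂ (inj₁ l)
  ... | no _  | yes r = inj₂ (inj₂ r)
  ... | no ¬l | no ¬r = inj₁ (¬l , ¬r)

  inner⇒¬outer : ∀ {w} → Inner w → ¬ Outer w
  inner⇒¬outer (¬l , _) (inj₁ l) = ¬l l
  inner⇒¬outer (_ , ¬r) (inj₂ r) = ¬r r

  L<inner : ∀ {u w} → L u → Inner w → u Fin.< w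
  L<inner {u} {w} l (¬l , _) with Fin.<-cmp u w
  ... | tri< u<w _ _  = u<w
  ... | tri≈ _ refl _ = contradiction l ¬l
  ... | tri> _ _ w<u  = contradiction (L-down w<u l) ¬l

  inner<R : ∀ {w v} → Inner w → R v → w Fin.< v
  inner<R {w} {v} (_ , ¬r) r with Fin.<-cmp w v
  ... | tri< w<v _ _  = w<v
  ... | tri≈ _ refl _ = contradiction r ¬r
  ... | tri> _ _ v<w  = contradiction (R-up v<w r) ¬r

  -- The map is total but constrained only on `S`, which avoids maps on subtypes and keeps the
  -- search over functions applicable.
  PartialCopy : (Fin m → Set) → ∀ {n} → OGraph n → (Fin m → Fin n) → Set
  PartialCopy S H φ = ∀ u v → S u → S v →
    (u Fin.< v → φ u Fin.< φ v) × (IsEdge G u v → IsEdge H (φ u) (φ v))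

  -- `In` keeps the inner vertices in the half-open interval from `a` to `b`; `Out` keeps exactly
  -- that interval free. Thus the two fit together at equal `a` and `b`.
  In : ∀ {n} → OGraph n → ℕ → ℕ → Set
  In {n} H a b = Σ (Fin m → Fin n) λ φ →
    PartialCopy Inner H φ × (∀ w → Inner w → a ≤ toℕ (φ w) × toℕ (φ w) < b)

  Out : ∀ {n} → OGraph n → ℕ → ℕ → Set
  Out {n} H a b = Σ (Fin m → Fin n) λ ψ →
    PartialCopy Outer H ψ × (∀ w → L w → toℕ (ψ w) < a) × (∀ w → R w → b ≤ toℕ (ψ w))

  In-mono : ∀ {n} (H : OGraph n) {a a′ b} → a′ ≤ a → In H a b → In H a′ b
  In-mono _ a′≤a (φ , copy , range) = φ , copy , λ w i →
    let (a≤ , <b) = range w i in ≤-trans a′≤a a≤ , <b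

  Out-mono : ∀ {n} (H : OGraph n) {a a′ b} → a ≤ a′ → Out H a b → Out H a′ b
  Out-mono _ a≤a′ (ψ , copy , left , right) = ψ , copy , (λ w l → <-≤-trans (left w l) a≤a′) , right

  in? : ∀ {n} (H : OGraph n) a b → Dec (In H a b)
  in? H a b = searchable-Vector refl searchable-Fin m
    (λ φ≡ψ (copy , range) →
      (λ u v su sv → let (mono , emb) = copy u v su sv in
        (λ u<v → subst₂ Fin._<_ (φ≡ψ u) (φ≡ψ v) (mono u<v)) ,
        (λ uv → IsEdge-resp {H = H} (φ≡ψ u) (φ≡ψ v) (emb uv))) ,
      (λ w i → subst (λ p → a ≤ toℕ p × toℕ p < b) (φ≡ψ w) (range w i)))
    (λ φ →
      Fin.all? (λ u → Fin.all? λ v → inner? u →-dec inner? v →-dec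
        ((u Fin.<? v) →-dec (φ u Fin.<? φ v)) ×-dec (isEdge? G u v →-dec isEdge? H (φ u) (φ v))) ×-dec
      Fin.all? (λ w → inner? w →-dec ((a ≤? toℕ (φ w)) ×-dec (toℕ (φ w) <? b))))
    where
    inner? : Decidable Inner
    inner? w = ¬? (L? w) ×-dec ¬? (R? w)

  -- Each edge of `G` has both ends inner or both outer, so the piecewise map loses none. The ranges
  -- place `L` before and `R` after the inner copy, which settles the order of mixed pairs.
  glue : ∀ {n} (H : OGraph n) {a b} → In H a b → Out H a b → Contains H G
  glue {n} H (φ , φ-copy , range) (ψ , ψ-copy , left , right) = χ , χ-mono , χ-emb
    where
    χ : Fin m → Fin n
    χ w = [ (λ _ → φ w) , (λ _ → ψ w) ]′ (place w)

    χ-mono : ∀ u v → u Fin.< v → χ u Fin.< χ v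
    χ-mono u v u<v with place u | place v
    ... | inj₁ i        | inj₁ i′        = proj₁ (φ-copy u v i i′) u<v
    ... | inj₂ o        | inj₂ o′        = proj₁ (ψ-copy u v o o′) u<v
    ... | inj₁ (¬l , _) | inj₂ (inj₁ l)  = contradiction (L-down u<v l) ¬l
    ... | inj₁ i        | inj₂ (inj₂ r)  = <-≤-trans (proj₂ (range u i)) (right v r)
    ... | inj₂ (inj₁ l) | inj₁ i         = <-≤-trans (left u l) (proj₁ (range v i))
    ... | inj₂ (inj₂ r) | inj₁ (_ , ¬r)  = contradiction (R-up u<v r) ¬r

    χ-emb : ∀ u v → IsEdge G u v → IsEdge H (χ u) (χ v)
    χ-emb u v uv with c u v in cuv
    ... | false with inner-edge uv cuv
    ...   | i , i′ with place u | place v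
    ...     | inj₁ _ | inj₁ _ = proj₂ (φ-copy u v i i′) uv
    ...     | inj₂ o | _      = contradiction o (inner⇒¬outer i)
    ...     | inj₁ _ | inj₂ o = contradiction o (inner⇒¬outer i′)
    χ-emb u v uv | true with outer-edge uv cuv
    ...   | o , o′ with place u | place v
    ...     | inj₂ _ | inj₂ _ = proj₂ (ψ-copy u v o o′) uv
    ...     | inj₁ i | _      = contradiction o (inner⇒¬outer i)
    ...     | inj₂ _ | inj₁ i = contradiction o′ (inner⇒¬outer i)

  -- In the copy of G created by xy, one class of edges avoids xy and lies in H.
  forced-edge : ∀ {n} {H : OGraph n} → Saturates H G → ∀ {x y} → x Fin.< y →
    ¬ Out H (toℕ x) (suc (toℕ y)) →
    (∀ {u v} φ → IsEdge G u v → c u v ≡ true → (∀ u v → u Fin.< v → φ u Fin.< φ v) →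
      PartialCopy Inner H φ → φ u ≡ x → φ v ≡ y → ⊥) →
    IsEdge H x y
  forced-edge {H = H} (avoids , sat) {x} {y} x<y ¬out ¬in with H x y in hxy
  ... | true  = x<y , refl
  ... | false with sat x y (x<y , hxy)
  ...   | φ , mono , emb = contradiction (φ , mono , in-H) avoids
    where
    -- If the vertex sent to `x` is outside `S`, then by injectivity no edge within `S` is sent to
    -- `xy`, so the edges within `S` land in `H`.
    restrict : ∀ {S : Fin m → Set} {u} → ¬ S u → φ u ≡ x → PartialCopy S H φ
    restrict ¬Su φu≡x u′ v′ Su′ _ = mono u′ v′ , λ e → mono u′ v′ (proj₁ e) ,
      [ (λ (φu′≡x , _) → contradiction
          (subst _ (strictMono⇒injective φ mono (trans φu′≡x (sym φu≡x))) Su′) ¬Su)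
      , id ]′ (addEdge⁻ H x y (proj₂ (emb u′ v′ e)))

    in-H : ∀ u v → IsEdge G u v → IsEdge H (φ u) (φ v)
    in-H u v uv with addEdge⁻ H x y (proj₂ (emb u v uv))
    ... | inj₂ h = mono u v (proj₁ uv) , h
    ... | inj₁ (φu≡x , φv≡y) with c u v in cuv
    -- An edge of E₁ sent to `xy` leaves the inner copy in `H`, against `¬in`. An edge of E₂ sent
    -- there leaves the outer copy in `H`, with `L` left of `x` and `R` right of `y`, against
    -- `¬out`.
    ...   | true  = contradiction φv≡y (¬in φ uv cuv mono
                      (restrict (λ i → inner⇒¬outer i (proj₁ (outer-edge uv cuv))) φu≡x) φu≡x)
    ...   | false = contradiction
      ( φ , restrict (inner⇒¬outer i) φu≡x
      , (λ w l → subst (φ w Fin.<_) φu≡x (mono w u (L<inner l i)))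
      , (λ w r → subst (Fin._< φ w) φv≡y (mono v w (inner<R i′ r))) ) ¬out
      where
      i  = proj₁ (inner-edge uv cuv)
      i′ = proj₂ (inner-edge uv cuv)

-- Separable and nested graphs as two-part graphs

module _ {m} (G : OGraph m) (c : Fin m → Fin m → Bool) where

  -- Sides are defined by the order relative to E₂ alone, so isolated vertices of `G` receive a
  -- place too.
  LeftOf RightOf : Fin m → Set
  LeftOf  w = ∀ u v → IsEdge G u v → c u v ≡ false → w Fin.< u
  RightOf w = ∀ u v → IsEdge G u v → c u v ≡ false → v Fin.< w

  leftOf? : Decidable LeftOf
  leftOf? w = Fin.all? λ u → Fin.all? λ v →
    isEdge? G u v →-dec (c u v Bool.≟ false) →-dec (w Fin.<? u)

  rightOf? : Decidable RightOf
  rightOf? w = Fin.all? λ u → Fin.all? λ v →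
    isEdge? G u v →-dec (c u v Bool.≟ false) →-dec (v Fin.<? w)

  LeftOf-down : ∀ {u v} → u Fin.< v → LeftOf v → LeftOf u
  LeftOf-down u<v l a b ab cab = <-trans u<v (l a b ab cab)

  RightOf-up : ∀ {u v} → u Fin.< v → RightOf u → RightOf v
  RightOf-up u<v r a b ab cab = <-trans (r a b ab cab) u<v

  ¬LeftOf : ∀ {u v} → IsEdge G u v → c u v ≡ false → ¬ LeftOf u × ¬ LeftOf v
  ¬LeftOf uv cuv = (λ l → <-irrefl refl (l _ _ uv cuv)) , (λ l → <-asym (proj₁ uv) (l _ _ uv cuv))

  ¬RightOf : ∀ {u v} → IsEdge G u v → c u v ≡ false → ¬ RightOf u × ¬ RightOf v
  ¬RightOf uv cuv = (λ r → <-asym (proj₁ uv) (r _ _ uv cuv)) , (λ r → <-irrefl refl (r _ _ uv cuv))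

-- A spanning star: its centre z is the first vertex with no copy of E₂ to its right.
separable-lower : ∀ {m} (G : OGraph m) → Separable G → ∀ {n} (H : OGraph (suc n)) → Saturates H G →
                  n ≤ 2 * edgeCount H
separable-lower {m} G (c , (u₁ , v₁ , uv₁ , c₁) , (u₂ , v₂ , uv₂ , c₂) , sep) {n} H sat@(avoids , _) =
  star (least (λ z → ¬? (in? H (suc z) (suc n))) no-room)
  where
  outer-L : ∀ {u v} → IsEdge G u v → c u v ≡ true → LeftOf G c u × LeftOf G c v
  outer-L uv cuv =
    (λ a b ab cab → let (_ , v<a , _) = sep _ _ a b uv cuv ab cab in <-trans (proj₁ uv) v<a) ,
    (λ a b ab cab → let (_ , v<a , _) = sep _ _ a b uv cuv ab cab in v<a)

  -- Here `R` is empty: vertices to the right of E₂ count as inner.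
  Nowhere : Fin m → Set
  Nowhere _ = ⊥

  nowhere? : Decidable Nowhere
  nowhere? _ = no id

  inner-edge : ∀ {u v} → IsEdge G u v → c u v ≡ false →
               (¬ LeftOf G c u × ¬ Nowhere u) × (¬ LeftOf G c v × ¬ Nowhere v)
  inner-edge uv cuv = let (¬u , ¬v) = ¬LeftOf G c uv cuv in (¬u , id) , (¬v , id)

  outer-edge : ∀ {u v} → IsEdge G u v → c u v ≡ true →
               (LeftOf G c u ⊎ Nowhere u) × (LeftOf G c v ⊎ Nowhere v)
  outer-edge uv cuv = let (u , v) = outer-L uv cuv in inj₁ u , inj₁ v

  open TwoPart G c (LeftOf G c) Nowhere (leftOf? G c) nowhere? (LeftOf-down G c) (λ _ r → r)
    inner-edge outer-edge

  inner₂ : Inner u₂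
  inner₂ = proj₁ (¬LeftOf G c uv₂ c₂) , id

  no-room : ¬ In H (suc n) (suc n)
  no-room (_ , _ , range) = let (n< , <n) = range u₂ inner₂ in <-irrefl refl (≤-<-trans n< <n)

  star : ∃[ z ] (¬ In H (suc z) (suc n) × z ≤ n × (∀ j → ¬ In H (suc j) (suc n) → z ≤ j)) →
         n ≤ 2 * edgeCount H
  -- The z vertices before the centre give one edge in each of their rows, the n - z vertices after
  -- it give edges in the row of the centre. Each group is bounded by the full edge count, hence the
  -- factor 2.
  star (z , ¬in , z≤N , min) = begin
    n                             ≡⟨ m+[n∸m]≡n z≤N ⟨
    z + (n ∸ z)                   ≡⟨ cong₂ _+_ (*-identityʳ z) (*-identityʳ (n ∸ z)) ⟨
    z * 1 + (n ∸ z) * 1           ≤⟨ +-mono-≤ backward forward ⟩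
    edgeCount H + edgeCount H     ≡⟨ cong (edgeCount H +_) (+-identityʳ (edgeCount H)) ⟨
    2 * edgeCount H               ∎
    where
    open ≤-Reasoning

    ¬out : ∀ {b} → ¬ Out H z b
    ¬out (ψ , copy , left , _) = go z ¬in min left
      where
      -- At 0 the vertex `u₁` has no place. Otherwise minimality yields a copy of E₂ to the right of
      -- z - 1, which glues with the copy of E₁ to the left of z.
      go : ∀ z → ¬ In H (suc z) (suc n) → (∀ j → ¬ In H (suc j) (suc n) → z ≤ j) →
           (∀ w → LeftOf G c w → toℕ (ψ w) < z) → ⊥
      go zero    _   _   left = n≮0 (left u₁ (proj₁ (outer-L uv₁ c₁)))
      go (suc z) ¬in min left with in? H (suc z) (suc n)
      ... | yes i = avoids (glue H i (ψ , copy , left , λ _ ()))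
      ... | no ¬i = <-irrefl refl (min z ¬i)

    -- If an edge of E₁ went to `xy`, its right end in `L` would push the whole inner copy beyond
    -- `y`, hence beyond `z`.
    edge : ∀ {x y} → x Fin.< y → toℕ x ≤ z → z ≤ toℕ y → IsEdge H x y
    edge x<y x≤z z≤y = forced-edge {H = H} sat x<y (¬out ∘ Out-mono H x≤z)
      λ φ uv cuv mono copy _ φv≡y → ¬in (In-mono H (s≤s z≤y)
        (φ , copy , λ w i → subst (Fin._< φ w) φv≡y (mono _ w (L<inner (proj₂ (outer-L uv cuv)) i)) , Fin.toℕ<n (φ w)))

    centre : Fin (suc n)
    centre = fromℕ< (s≤s z≤N)

    centre≡z : toℕ centre ≡ z
    centre≡z = Fin.toℕ-fromℕ< (s≤s z≤N)

    backward : z * 1 ≤ edgeCount H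
    backward = ∑-lower 0 z 1 (row H) (m≤n⇒m≤1+n z≤N) λ x _ x<z →
      row-edge H (edge {x} {centre} (subst (toℕ x <_) (sym centre≡z) x<z) (<⇒≤ x<z) (≤-reflexive (sym centre≡z)))

    forward : (n ∸ z) * 1 ≤ edgeCount H
    forward = ≤-trans
      (∑-lower (suc z) (n ∸ z) 1 (λ v → 𝟙 (⌊ centre Fin.<? v ⌋ ∧ H centre v))
        (≤-reflexive (cong suc (m+[n∸m]≡n z≤N))) λ y z<y _ →
          entry-edge H (edge {centre} {y} (subst (_< toℕ y) (sym centre≡z) z<y) (≤-reflexive centre≡z) (<⇒≤ z<y)))
      (∑-term (row H) centre)

-- Every vertex x but the last is joined to the largest y such that E₂ has no copy strictly between them.
nested-lower : ∀ {m} (G : OGraph m) → Nested G → ∀ {n} (H : OGraph (suc n)) → Saturates H G →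
               n ≤ edgeCount H
nested-lower {m} G (c , (u₁ , v₁ , uv₁ , c₁) , (u₂ , v₂ , uv₂ , c₂) , nest) {n} H sat@(avoids , _) =
  subst (_≤ edgeCount H) (*-identityʳ n) (∑-lower 0 n 1 (row H) (n≤1+n n) λ x _ → row≥1 x)
  where
  outer-LR : ∀ {u v} → IsEdge G u v → c u v ≡ true → LeftOf G c u × RightOf G c v
  outer-LR uv cuv =
    (λ a b ab cab → let (u<a , _) = nest _ _ a b uv cuv ab cab in u<a) ,
    (λ a b ab cab → let (_ , _ , b<v) = nest _ _ a b uv cuv ab cab in b<v)

  inner-edge : ∀ {u v} → IsEdge G u v → c u v ≡ false →
               (¬ LeftOf G c u × ¬ RightOf G c u) × (¬ LeftOf G c v × ¬ RightOf G c v)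
  inner-edge uv cuv =
    let (lu , lv) = ¬LeftOf G c uv cuv
        (ru , rv) = ¬RightOf G c uv cuv
    in (lu , ru) , (lv , rv)

  outer-edge : ∀ {u v} → IsEdge G u v → c u v ≡ true →
               (LeftOf G c u ⊎ RightOf G c u) × (LeftOf G c v ⊎ RightOf G c v)
  outer-edge uv cuv = let (u , v) = outer-LR uv cuv in inj₁ u , inj₂ v

  open TwoPart G c (LeftOf G c) (RightOf G c) (leftOf? G c) (rightOf? G c) (LeftOf-down G c) (RightOf-up G c)
    inner-edge outer-edge

  inner₂ : Inner u₂
  inner₂ = proj₁ (¬LeftOf G c uv₂ c₂) , proj₁ (¬RightOf G c uv₂ c₂)

  In⇒< : ∀ {a b} → In H a b → a < b
  In⇒< (_ , _ , range) = let (a≤ , <b) = range u₂ inner₂ in ≤-<-trans a≤ <b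

  row≥1 : ∀ x → toℕ x < n → 1 ≤ row H x
  -- Here a copy of E₂ may use `y` itself, so minimality excludes copies strictly between `x` and
  -- `y`. The alternative `n ≤ y` ends the search at the last vertex.
  row≥1 x x<n with least (λ y → in? H (suc (toℕ x)) (suc y) ⊎-dec (n ≤? y)) (inj₂ ≤-refl)
  ... | y , stop , y≤n , min = row-edge H (forced-edge {H = H} sat {x} {partner}
          (subst (toℕ x <_) (sym partner≡y) x<y)
          (λ o → ¬out stop (subst (λ y → Out H (toℕ x) (suc y)) partner≡y o))
          λ φ uv cuv mono copy φu≡x φv≡y →
            let (l , r) = outer-LR uv cuv in
            ¬in y min (φ , copy , λ w i →
              subst (Fin._< φ w) φu≡x (mono _ w (L<inner l i)) ,
              subst (toℕ (φ w) <_) (trans (cong toℕ φv≡y) partner≡y) (mono w _ (inner<R i r))))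
    where
    Stop : ℕ → Set
    Stop y = In H (suc (toℕ x)) (suc y) ⊎ n ≤ y

    partner : Fin (suc n)
    partner = fromℕ< (s≤s y≤n)

    partner≡y : toℕ partner ≡ y
    partner≡y = Fin.toℕ-fromℕ< (s≤s y≤n)

    x<y : toℕ x < y
    x<y = [ (λ i → m<1+n⇒m≤n (In⇒< i)) , <-≤-trans x<n ]′ stop

    -- A copy of E₂ after `x` and up to `y` would glue with a copy of E₁ around it; if `y` is the
    -- last vertex, `v₁` has no place beyond it.
    ¬out : ∀ {y} → Stop y → ¬ Out H (toℕ x) (suc y)
    ¬out (inj₁ i)   o = avoids (glue H i (Out-mono H (n≤1+n (toℕ x)) o))
    ¬out (inj₂ n≤y) (ψ , _ , _ , right) =
      <⇒≱ (Fin.toℕ<n (ψ v₁)) (≤-trans (s≤s n≤y) (right v₁ (proj₂ (outer-LR uv₁ c₁))))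

    ¬in : ∀ y → (∀ j → Stop j → y ≤ j) → ¬ In H (suc (toℕ x)) y
    ¬in zero    _   i = n≮0 (In⇒< i)
    ¬in (suc y) min i = <-irrefl refl (min y (inj₁ i))

-- Combining the linear lower and upper bounds

theorem2 : ∀ (m : ℕ) (G : OGraph m) → Separable G ⊎ Nested G →
    ∃[ C ] ∃[ D ] ∃[ n₀ ] ((0 < C) × (0 < D) ×
    (∀ n → n₀ ≤ n → ∃[ k ] (IsSat n G k × (n ≤ C * k) × (k ≤ D * n))))
-- The lower bounds give n - 1 ≤ 2k. From n ≥ 2 it follows that k ≥ 1, and adding the two yields n ≤
-- 3k. The constant `3 * m` comes from `edgeCount-upper`.
theorem2 m G split = 3 , 3 * m , 2 , s≤s z≤n , *-mono-≤ {1} {3} (s≤s z≤n) 0<m , bounds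
  where
  edge : ∃[ u ] ∃[ v ] IsEdge G u v
  edge = [ (λ (_ , (u , v , uv , _) , _) → u , v , uv) , (λ (_ , (u , v , uv , _) , _) → u , v , uv) ]′ split

  0<m : 0 < m
  0<m = ≤-trans (s≤s z≤n) (Fin.toℕ<n (proj₁ edge))

  lower : ∀ {n} (H : OGraph (suc n)) → Saturates H G → n ≤ 2 * edgeCount H
  lower H sat =
    [ (λ s → separable-lower G s H sat) , (λ s → ≤-trans (nested-lower G s H sat) (m≤m+n _ _)) ]′ split

  positive : ∀ {n} e → suc n ≤ 2 * e → 1 ≤ e
  positive (suc _) _ = s≤s z≤n

  bounds : ∀ n → 2 ≤ n → ∃[ k ] (IsSat n G k × (n ≤ 3 * k) × (k ≤ 3 * m * n))
  bounds n@(suc (suc _)) (s≤s (s≤s _)) = bound (saturated-linear G edge n)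
    where
    bound : (Σ (OGraph n) λ K → Saturates K G × edgeCount K ≤ 3 * m * n) →
            ∃[ k ] (IsSat n G k × (n ≤ 3 * k) × (k ≤ 3 * m * n))
    bound (K , satK , K≤) = attained (IsSat-exists G K satK)
      where
      attained : (∃[ k ] IsSat n G k) → ∃[ k ] (IsSat n G k × (n ≤ 3 * k) × (k ≤ 3 * m * n))
      attained (k , isSat@((H , satH , edges≡k) , min)) =
        k , isSat , subst (λ e → n ≤ 3 * e) edges≡k
          (+-mono-≤ (positive (edgeCount H) (lower H satH)) (lower H satH)) , ≤-trans (min K satK) K≤
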